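{- There exist absolute constants $c>0$ and $c_0\ge 1$ such that for every fast-memory size $M\ge 1$ and every power of two $n\ge c_0\sqrt{M}$, every implementation of Strassen's algorithm on two $n\times n$ matrices in the sequential two-level memory model with fast memory of size $M$, in which no intermediate value is computed twice, moves at least $$c\left(\frac{n}{\sqrt{M}}\right)^{\log_2 7}\cdot M$$ words between slow and fast memory. That is, $IO(n)=\Omega\big((n/\sqrt M)^{\log_2 7} M\big)$. The same holds for Winograd's variant of Strassen's algorithm (which uses 15 rather than 18 block additions per recursion step).
   Context: Strassen's algorithm, for $n\times n$ matrices $A,B$ with $n$ a power of two: if $n=1$, return $C_{11}=A_{11}B_{11}$. Otherwise, split $A,B$ into four $\frac n2\times\frac n2$ blocks and compute $M_1=(A_{11}+A_{22})(B_{11}+B_{22})$, $M_2=(A_{21}+A_{22})B_{11}$, $M_3=A_{11}(B_{12}-B_{22})$, $M_4=A_{22}(B_{21}-B_{11})$, $M_5=(A_{11}+A_{12})B_{22}$, $M_6=(A_{21}-A_{11})(B_{11}+B_{12})$, $M_7=(A_{12}-A_{22})(B_{21}+B_{22})$. The seven block products are computed recursively, and $C_{11}=M_1+M_4-M_5+M_7$, $C_{12}=M_3+M_5$, $C_{21}=M_2+M_4$, $C_{22}=M_1-M_2+M_3+M_6$. All block additions and subtractions are performed entrywise by binary scalar operations. Computation graph (CDAG): a directed acyclic graph with one vertex per input entry and one vertex per scalar arithmetic operation. There is an edge $(u,v)$ whenever the value of $u$ is an operand of the operation $v$. Sequential two-level memory model: - There is a fast memory holding at most $M$ words and an unbounded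 slow memory. - The input matrices initially reside in slow memory, and the outputs must end in slow memory. - A scalar arithmetic operation may be performed only when its operands are in fast memory, and its result is placed in fast memory. - Each word moved from slow to fast memory (read) or from fast to slow memory (write) counts as one unit of communication. An implementation is a schedule of reads, writes and arithmetic operations that computes every vertex of the CDAG exactly once (no recomputation), in an order consistent with the edges. $IO(n)$ denotes the minimum, over all such implementations, of the number of words moved. -}

module Defs where

open import Data.Fin.Base using (Fin; zero; suc; toℕ; inject; combine; remQuot)
open import Data.Integer.Base using (∣_∣)
open import Data.List.Base using (List; []; _∷_)
open import Data.List.Membership.Propositional using () renaming (_∈_ to _∈ᴸ_)
open import Data.List.Relation.Unary.Unique.Propositional using (Unique)
open import Data.Maybe.Base using (Maybe; just; nothing)
open import Data.Nat.Base using (ℕ; zero; suc; _*_; _^_; _≤_; NonZero)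
open import Data.Product.Base using (_×_; _,_; proj₁; proj₂)
open import Data.Rational.Base using (ℚ; ↥_; ↧ₙ_)
open import Data.Sum.Base using (_⊎_; inj₁; inj₂)
open import Data.Vec.Base using (Vec; replicate; _[_]≔_)
open import Data.Vec.Membership.Propositional using () renaming (_∈_ to _∈ⱽ_)
open import Function.Base using (_∘_)
open import Level using (0ℓ)
open import Relation.Unary using (Pred; _∪_; ｛_｝)

-- Computation graphs whose operations are all binary; the edges (u , v) are
-- given by the two operands u of each operation v.
record CDAG : Set₁ where
  field
    Input Op Output : Set
    operands : Op → (Input ⊎ Op) × (Input ⊎ Op)
    output   : Output → Op

  Vertex : Set
  Vertex = Input ⊎ Op

Block : Set
Block = Fin 2 × Fin 2

data Operand (X : Set) (m : ℕ) : Set where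
  given : X → Operand X m
  step  : Fin m → Operand X m

data Sum (X : Set) (m : ℕ) : Set where
  _⊕_ _⊖_ : (l r : Operand X m) → Sum X m

infix 5 _⊕_ _⊖_

-- Straight-line programs: step i may only refer to earlier steps.
Program : Set → ℕ → Set
Program X m = (i : Fin m) → Sum X (toℕ i)

-- One level of a recursion with seven block products. The S i are block sums
-- of A, the T i block sums of B, product r is left r times right r, and the
-- U i are block sums of the products.
record Scheme : Set where
  field
    nS nT nU : ℕ
    S      : Program Block nS
    T      : Program Block nT
    left   : Fin 7 → Operand Block nS
    right  : Fin 7 → Operand Block nT
    U      : Program (Fin 7) nU
    result : Block → Fin nU

pattern #1 = zero
pattern #2 = suc #1
pattern #3 = suc #2
pattern #4 = suc #3
pattern #5 = suc #4
pattern #6 = suc #5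
pattern #7 = suc #6
pattern #8 = suc #7

pattern X₁₁ = given (#1 , #1)
pattern X₁₂ = given (#1 , #2)
pattern X₂₁ = given (#2 , #1)
pattern X₂₂ = given (#2 , #2)

strassen : Scheme
strassen = record
  { nS = 5 ; nT = 5 ; nU = 8
  ; S = λ { #1 → X₁₁ ⊕ X₂₂
          ; #2 → X₂₁ ⊕ X₂₂
          ; #3 → X₁₁ ⊕ X₁₂
          ; #4 → X₂₁ ⊖ X₁₁
          ; #5 → X₁₂ ⊖ X₂₂ }
  ; T = λ { #1 → X₁₁ ⊕ X₂₂
          ; #2 → X₁₂ ⊖ X₂₂
          ; #3 → X₂₁ ⊖ X₁₁
          ; #4 → X₁₁ ⊕ X₁₂
          ; #5 → X₂₁ ⊕ X₂₂ }
  ; left  = λ { #1 → step #1 ; #2 → step #2 ; #3 → X₁₁ ; #4 → X₂₂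
              ; #5 → step #3 ; #6 → step #4 ; #7 → step #5 }
  ; right = λ { #1 → step #1 ; #2 → X₁₁ ; #3 → step #2 ; #4 → step #3
              ; #5 → X₂₂ ; #6 → step #4 ; #7 → step #5 }
  -- C₁₁ and C₂₂ are summed from left to right.
  ; U = λ { #1 → given #1 ⊕ given #4
          ; #2 → step #1  ⊖ given #5
          ; #3 → step #2  ⊕ given #7
          ; #4 → given #3 ⊕ given #5
          ; #5 → given #2 ⊕ given #4
          ; #6 → given #1 ⊖ given #2
          ; #7 → step #6  ⊕ given #3
          ; #8 → step #7  ⊕ given #6 }
  ; result = λ { (#1 , #1) → #3 ; (#1 , #2) → #4
               ; (#2 , #1) → #5 ; (#2 , #2) → #8 }
  }

-- S₁ = A₂₁ + A₂₂    T₁ = B₁₂ − B₁₁    P₁ = A₁₁B₁₁    U₁ = P₁ + P₂ = C₁₁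
-- S₂ = S₁ − A₁₁     T₂ = B₂₂ − T₁     P₂ = A₁₂B₂₁    U₂ = P₁ + P₆
-- S₃ = A₁₁ − A₂₁    T₃ = B₂₂ − B₁₂    P₃ = S₄B₂₂     U₃ = U₂ + P₇
-- S₄ = A₁₂ − S₂     T₄ = T₂ − B₂₁     P₄ = A₂₂T₄     U₄ = U₂ + P₅
--                                     P₅ = S₁T₁      U₅ = U₄ + P₃ = C₁₂
--                                     P₆ = S₂T₂      U₆ = U₃ − P₄ = C₂₁
--                                     P₇ = S₃T₃      U₇ = U₃ + P₅ = C₂₂
winograd : Scheme
winograd = record
  { nS = 4 ; nT = 4 ; nU = 7
  ; S = λ { #1 → X₂₁ ⊕ X₂₂
          ; #2 → step #1 ⊖ X₁₁
          ; #3 → X₁₁ ⊖ X₂₁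
          ; #4 → X₁₂ ⊖ step #2 }
  ; T = λ { #1 → X₁₂ ⊖ X₁₁
          ; #2 → X₂₂ ⊖ step #1
          ; #3 → X₂₂ ⊖ X₁₂
          ; #4 → step #2 ⊖ X₂₁ }
  ; left  = λ { #1 → X₁₁ ; #2 → X₁₂ ; #3 → step #4 ; #4 → X₂₂
              ; #5 → step #1 ; #6 → step #2 ; #7 → step #3 }
  ; right = λ { #1 → X₁₁ ; #2 → X₂₁ ; #3 → X₂₂ ; #4 → step #4
              ; #5 → step #1 ; #6 → step #2 ; #7 → step #3 }
  ; U = λ { #1 → given #1 ⊕ given #2
          ; #2 → given #1 ⊕ given #6
          ; #3 → step #2  ⊕ given #7
          ; #4 → step #2  ⊕ given #5
          ; #5 → step #4  ⊕ given #3
          ; #6 → step #3  ⊖ given #4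
          ; #7 → step #3  ⊕ given #5 }
  ; result = λ { (#1 , #1) → #1 ; (#1 , #2) → #5
               ; (#2 , #1) → #6 ; (#2 , #2) → #7 }
  }

Entry : ℕ → Set
Entry k = Fin (2 ^ k) × Fin (2 ^ k)

inBlock : ∀ {n} → Block → Fin n × Fin n → Fin (2 * n) × Fin (2 * n)
inBlock (i , j) (x , y) = combine i x , combine j y

splitEntry : ∀ {n} → Fin (2 * n) × Fin (2 * n) → Block × (Fin n × Fin n)
splitEntry {n} (x , y) =
  let (i , x′) = remQuot {2} n x
      (j , y′) = remQuot {2} n y
  in (i , j) , (x′ , y′)

module _ (s : Scheme) where
  open Scheme s

  data ScalarOp : ℕ → Set where
    mul  : ScalarOp zero
    addS : ∀ {k} → Fin nS → Entry k → ScalarOp (suc k)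
    addT : ∀ {k} → Fin nT → Entry k → ScalarOp (suc k)
    call : ∀ {k} → Fin 7 → ScalarOp k → ScalarOp (suc k)
    addU : ∀ {k} → Fin nU → Entry k → ScalarOp (suc k)

  resultOp : ∀ {k} → Entry k → ScalarOp k
  resultOp {zero}  _ = mul
  resultOp {suc k} e = let (b , e′) = splitEntry {2 ^ k} e in addU (result b) e′

module _ {V X : Set} {m : ℕ} (g : X → V) (t : Fin m → V) where

  operandVertex : Operand X m → V
  operandVertex (given x) = g x
  operandVertex (step i)  = t i

  sumVertices : Sum X m → V × V
  sumVertices (l ⊕ r) = operandVertex l , operandVertex r
  sumVertices (l ⊖ r) = operandVertex l , operandVertex r

-- Here V is the vertex set of the whole graph; A and B are the vertices
-- holding the factors of the current recursive call, and ι places the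
-- operations of the call in the graph.
scalarOperands : (s : Scheme) {V : Set} {k : ℕ} (A B : Entry k → V)
                 (ι : ScalarOp s k → V) → ScalarOp s k → V × V
scalarOperands s A B ι mul = A (zero , zero) , B (zero , zero)
scalarOperands s A B ι (addS i e) =
  sumVertices (λ b → A (inBlock b e)) (λ j → ι (addS (inject j) e))
              (Scheme.S s i)
scalarOperands s A B ι (addT i e) =
  sumVertices (λ b → B (inBlock b e)) (λ j → ι (addT (inject j) e))
              (Scheme.T s i)
scalarOperands s A B ι (call r o) =
  scalarOperands s
    (λ e → operandVertex (λ b → A (inBlock b e)) (λ j → ι (addS j e))
                         (Scheme.left s r))
    (λ e → operandVertex (λ b → B (inBlock b e)) (λ j → ι (addT j e))
                         (Scheme.right s r))
    (ι ∘ call r) o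
scalarOperands s A B ι (addU i e) =
  sumVertices (λ r → ι (call r (resultOp s e))) (λ j → ι (addU (inject j) e))
              (Scheme.U s i)

-- The inputs are the entries of A (inj₁) and of B (inj₂).
schemeCDAG : Scheme → ℕ → CDAG
schemeCDAG s k = record
  { Input    = Entry k ⊎ Entry k
  ; Op       = ScalarOp s k
  ; Output   = Entry k
  ; operands = scalarOperands s (inj₁ ∘ inj₁) (inj₁ ∘ inj₂) inj₂
  ; output   = resultOp s
  }

module Machine (G : CDAG) (M : ℕ) where
  open CDAG G

  -- Fast memory consists of M cells of one word each. Overwriting a cell
  -- costs nothing, and a result may overwrite one of its own operands.
  record State : Set₁ where
    constructor _∣_
    field
      fast : Vec (Maybe Vertex) M
      slow : Pred Vertex 0ℓ

  data Action : Set where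
    read write : Vertex → Action
    compute    : Op → Action

  data Step : State → Action → State → Set₁ where
    read    : ∀ {F S v} (i : Fin M) → S v →
              Step (F ∣ S) (read v) ((F [ i ]≔ just v) ∣ S)
    write   : ∀ {F S v} → just v ∈ⱽ F →
              Step (F ∣ S) (write v) (F ∣ (S ∪ ｛ v ｝))
    compute : ∀ {F S o} (i : Fin M) →
              just (proj₁ (operands o)) ∈ⱽ F →
              just (proj₂ (operands o)) ∈ⱽ F →
              Step (F ∣ S) (compute o) ((F [ i ]≔ just (inj₂ o)) ∣ S)

  data Run : State → List Action → State → Set₁ where
    []  : ∀ {σ} → Run σ [] σ
    _∷_ : ∀ {σ τ υ a as} → Step σ a τ → Run τ as υ → Run σ (a ∷ as) υ

  data IsInput : Pred Vertex 0ℓ where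
    isInput : (x : Input) → IsInput (inj₁ x)

  initial : State
  initial = replicate M nothing ∣ IsInput

  computed : List Action → List Op
  computed []               = []
  computed (read _ ∷ as)    = computed as
  computed (write _ ∷ as)   = computed as
  computed (compute o ∷ as) = o ∷ computed as

  wordsMoved : List Action → ℕ
  wordsMoved []               = 0
  wordsMoved (read _ ∷ as)    = suc (wordsMoved as)
  wordsMoved (write _ ∷ as)   = suc (wordsMoved as)
  wordsMoved (compute _ ∷ as) = wordsMoved as

  record Implementation : Set₁ where
    field
      schedule      : List Action
      final         : State
      run           : Run initial schedule final
      computesAll   : ∀ o → o ∈ᴸ computed schedule
      noRecompute   : Unique (computed schedule)
      outputsInSlow : ∀ e → State.slow final (inj₂ (output e))

    communication : ℕ
    communication = wordsMoved schedule

-- n ≥ c₀ √M, squared, for c₀ ≥ 0.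
_≥_√_ : ℕ → ℚ → ℕ → Set
n ≥ c₀ √ M = ∣ ↥ c₀ ∣ ^ 2 * M ≤ ↧ₙ c₀ ^ 2 * n ^ 2

-- w ≥ c (n / √M) ^ (log₂ 7) · M, for c > 0, M > 0 and n ≥ √M. The base being
-- at least 1, its real power is the supremum of its powers with rational
-- exponent p / q ≤ log₂ 7, that is, 2 ^ p ≤ 7 ^ q. The inequality
-- w ≥ c (n / √M) ^ (p / q) · M is raised to the power 2q and cleared of
-- denominators.
_≥_⟨_/√_⟩^log₂7·M : ℕ → ℚ → ℕ → ℕ → Set
w ≥ c ⟨ n /√ M ⟩^log₂7·M =
  ∀ p q .{{_ : NonZero q}} → 2 ^ p ≤ 7 ^ q →
  (∣ ↥ c ∣ * M) ^ (2 * q) * n ^ (2 * p) ≤ (↧ₙ c * w) ^ (2 * q) * M ^ p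

{-# OPTIONS --safe #-}

-- A recursive call on 2ʲ × 2ʲ matrices with 4ʲ a large enough constant times M
-- has to write at least M of its own intermediate values, even if its
-- arguments and its results are free: cut the schedule when 3/7 of the 7ʲ
-- products of the call have been computed. If a set χ of operations is closed
-- under operands, every pair of a product and a result of which exactly one
-- lies in χ is separated somewhere along the chain of calls between the two,
-- and each boundary vertex (a value in χ that an operation outside χ needs) is
-- responsible for at most 4·7ʲ of these pairs. At the cut a constant fraction
-- of the 4ʲ·7ʲ pairs is separated, so there are at least 2M boundary vertices.
-- They cannot be recomputed and at most M of them are in fast memory, so the
-- others have been written. The 7ᵈ calls at depth d have disjoint sets of
-- operations; hence at least 7ᵈ M words are moved.

module Submission where

open import Defs
open import Data.Bool.Base using (Bool; true; false; _xor_)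
open import Data.Bool.Properties using () renaming (_≟_ to _≟ᴮ_)
open import Data.Empty using (⊥; ⊥-elim)
open import Data.Fin.Base using (Fin; zero; suc; inject)
open import Data.Fin.Properties using (all?; remQuot-combine; combine-remQuot; combine-injective)
  renaming (_≟_ to _≟ᶠ_)
open import Data.Integer.Base using (+<+; +≤+) renaming (+_ to pos)
open import Data.List.Base using (List; []; _∷_; _++_; length; map; filter; allFin; cartesianProduct; cartesianProductWith)
open import Data.List.Membership.Propositional using (_∈_; _∉_)
open import Data.List.Membership.Propositional.Properties using (∈-++⁺ˡ; ∈-++⁺ʳ; ∈-++⁻; ∈-∃++; ∈-filter⁺; ∈-filter⁻)
open import Data.List.Properties using (++-assoc; length-++; length-map; map-cong; map-++; map-∘)
open import Data.List.Relation.Unary.All as All using (All; []; _∷_)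
import Data.List.Relation.Unary.All.Properties as All
open import Data.List.Relation.Unary.AllPairs using ([]; _∷_)
open import Data.List.Relation.Unary.Any using (here; there)
open import Data.List.Relation.Unary.Unique.Propositional using (Unique)
import Data.List.Relation.Unary.Unique.Propositional.Properties as Unique
open import Data.Maybe.Base using (Maybe; just)
open import Data.Maybe.Properties using (just-injective)
open import Data.Nat.Base using (ℕ; zero; suc; _+_; _*_; _∸_; _^_; _≤_; z≤n; s≤s)
open import Data.Nat.Coprimality using (1-coprimeTo) renaming (sym to coprime-sym)
open import Data.Nat.ListAction using (sum)
open import Data.Nat.ListAction.Properties using (sum-++)
open import Data.Nat.Properties
open import Data.Nat.Tactic.RingSolver using (solve-∀)
open import Data.Product.Base as Product using (_×_; _,_; proj₁; proj₂; ∃; ∃₂; ∃-syntax; uncurry)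
open import Data.Rational.Base using (ℚ; mkℚ; 0ℚ; 1ℚ; *<*; *≤*) renaming (_<_ to _<ℚ_; _≤_ to _≤ℚ_)
open import Data.Sum.Base as Sum using (_⊎_; inj₁; inj₂; [_,_]′)
open import Data.Sum.Properties using (inj₂-injective; ≡-dec)
open import Data.Vec.Base using (Vec; []; _∷_; replicate; toList; _[_]≔_)
open import Data.Vec.Membership.Propositional using () renaming (_∈_ to _∈ⱽ_)
open import Data.Vec.Membership.Propositional.Properties using (∈-toList⁺)
open import Data.Vec.Properties using (length-toList)
open import Data.Vec.Relation.Unary.Any using (here; there)
open import Function.Base using (_∘_; id; const)
open import Relation.Binary.Construct.Closure.Equivalence using (EqClosure; symmetric)
open import Relation.Binary.Construct.Closure.ReflexiveTransitive using (ε; _◅_; _◅◅_)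
open import Relation.Binary.Construct.Closure.Symmetric using (SymClosure; fwd; bwd)
open import Relation.Binary.PropositionalEquality using (_≡_; _≢_; refl; sym; trans; cong; cong₂; subst; module ≡-Reasoning)
open import Relation.Nullary.Decidable using (Dec; _⊎-dec_; ¬?; from-yes)
open import Relation.Nullary.Negation using (¬_)

private variable
  A B C I : Set
  k m n   : ℕ

-- Finite sums over lists

∑ : List A → (A → ℕ) → ℕ
∑ xs f = sum (map f xs)

module _ {f g : A → ℕ} where

  ∑-cong : (∀ x → f x ≡ g x) → ∀ xs → ∑ xs f ≡ ∑ xs g
  ∑-cong f≡g xs = cong sum (map-cong f≡g xs)

  ∑-mono : (∀ x → f x ≤ g x) → ∀ xs → ∑ xs f ≤ ∑ xs g
  ∑-mono f≤g []       = z≤n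
  ∑-mono f≤g (x ∷ xs) = +-mono-≤ (f≤g x) (∑-mono f≤g xs)

∑-+ : ∀ (xs : List A) (f g : A → ℕ) → ∑ xs (λ x → f x + g x) ≡ ∑ xs f + ∑ xs g
∑-+ []       f g = refl
∑-+ (x ∷ xs) f g = trans (cong (f x + g x +_) (∑-+ xs f g)) (interchange (f x) (g x) _ _)
  where
  interchange : ∀ a b c d → a + b + (c + d) ≡ a + c + (b + d)
  interchange = solve-∀

∑-* : ∀ (xs : List A) c (f : A → ℕ) → ∑ xs (λ x → c * f x) ≡ c * ∑ xs f
∑-* []       c f = sym (*-zeroʳ c)
∑-* (x ∷ xs) c f = trans (cong (c * f x +_) (∑-* xs c f)) (sym (*-distribˡ-+ c (f x) _))

∑-const : ∀ (xs : List A) c → ∑ xs (λ _ → c) ≡ length xs * c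
∑-const []       c = refl
∑-const (x ∷ xs) c = cong (c +_) (∑-const xs c)

∑-swap : ∀ (xs : List A) (ys : List B) (f : A → B → ℕ) →
         ∑ xs (λ x → ∑ ys (f x)) ≡ ∑ ys (λ y → ∑ xs (λ x → f x y))
∑-swap []       ys f = sym (trans (∑-const ys 0) (*-zeroʳ (length ys)))
∑-swap (x ∷ xs) ys f = trans (cong (∑ ys (f x) +_) (∑-swap xs ys f)) (sym (∑-+ ys (f x) _))

∑-cartesianProductWith : ∀ (f : A → B → C) xs ys (g : C → ℕ) →
  ∑ (cartesianProductWith f xs ys) g ≡ ∑ xs (λ x → ∑ ys (λ y → g (f x y)))
∑-cartesianProductWith f []       ys g = refl
∑-cartesianProductWith f (x ∷ xs) ys g =
  trans (cong sum (map-++ g (map (f x) ys) _))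
 (trans (sum-++ (map g (map (f x) ys)) _)
        (cong₂ _+_ (cong sum (sym (map-∘ ys))) (∑-cartesianProductWith f xs ys g)))

length-cartesianProductWith : ∀ (f : A → B → C) xs ys →
  length (cartesianProductWith f xs ys) ≡ length xs * length ys
length-cartesianProductWith f []       ys = refl
length-cartesianProductWith f (x ∷ xs) ys =
  trans (length-++ (map (f x) ys))
        (cong₂ _+_ (length-map (f x) ys) (length-cartesianProductWith f xs ys))

-- Meant for counts of separated pairs, with `B` the existence of a cut vertex, so that one cut can
-- pay for a whole count.
∑≡0⊎ : {f : A → ℕ} → (∀ x → f x ≡ 0 ⊎ B) → ∀ xs → ∑ xs f ≡ 0 ⊎ B
∑≡0⊎ z []       = inj₁ refl
∑≡0⊎ z (x ∷ xs) with z x | ∑≡0⊎ z xs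
... | inj₂ b  | _        = inj₂ b
... | inj₁ _  | inj₂ b   = inj₂ b
... | inj₁ p  | inj₁ q   = inj₁ (cong₂ _+_ p q)

-- Boolean indicators and counting of distinct elements

⟦_⟧ : Bool → ℕ
⟦ false ⟧ = 0
⟦ true  ⟧ = 1

differ : Bool → Bool → ℕ
differ b c = ⟦ b xor c ⟧

differ-≡ : ∀ {b c} → b ≡ c → differ b c ≡ 0
differ-≡ {false} refl = refl
differ-≡ {true}  refl = refl

differ≤1 : ∀ b c → differ b c ≤ 1
differ≤1 false false = z≤n
differ≤1 false true  = ≤-refl
differ≤1 true  false = ≤-refl
differ≤1 true  true  = z≤n

differ-triangle : ∀ b c d → differ b d ≤ differ b c + differ c d
differ-triangle false false d = ≤-refl
differ-triangle false true  d = ≤-trans (differ≤1 false d) (s≤s z≤n)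
differ-triangle true  false d = ≤-trans (differ≤1 true d) (s≤s z≤n)
differ-triangle true  true  d = ≤-refl

unique⊆⇒length≤ : ∀ {xs ys : List A} → Unique xs → All (_∈ ys) xs → length xs ≤ length ys
unique⊆⇒length≤ [] [] = z≤n
unique⊆⇒length≤ {xs = x ∷ xs} (x∉xs ∷ xs!) (x∈ys ∷ xs⊆ys) with ∈-∃++ x∈ys
... | as , bs , refl = begin
  suc (length xs)             ≤⟨ s≤s (unique⊆⇒length≤ xs! (All.map drop (All.zip (x∉xs , xs⊆ys)))) ⟩
  suc (length (as ++ bs))     ≡⟨ cong suc (length-++ as) ⟩
  suc (length as + length bs) ≡⟨ +-suc (length as) (length bs) ⟨
  length as + suc (length bs) ≡⟨ length-++ as ⟨
  length (as ++ x ∷ bs)       ∎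
  where
  open ≤-Reasoning
  drop : ∀ {y} → x ≢ y × y ∈ as ++ x ∷ bs → y ∈ as ++ bs
  drop (x≢y , y∈) with ∈-++⁻ as y∈
  ... | inj₁ y∈as          = ∈-++⁺ˡ y∈as
  ... | inj₂ (here y≡x)    = ⊥-elim (x≢y (sym y≡x))
  ... | inj₂ (there y∈bs)  = ∈-++⁺ʳ as y∈bs

count≡length-filter : ∀ (χ : A → Bool) xs → ∑ xs (⟦_⟧ ∘ χ) ≡ length (filter (λ x → χ x ≟ᴮ true) xs)
count≡length-filter χ [] = refl
count≡length-filter χ (x ∷ xs) with χ x
... | true  = cong suc (count≡length-filter χ xs)
... | false = count≡length-filter χ xs

-- Limits the jump of a count when its set of marked elements grows. With one action of a schedule
-- as the cause, the jump is at most one.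
count-growth : ∀ {χ χ′ : A → Bool} {new xs} → Unique xs →
               (∀ x → χ′ x ≡ true → x ∈ new ⊎ χ x ≡ true) →
               ∑ xs (⟦_⟧ ∘ χ′) ≤ length new + ∑ xs (⟦_⟧ ∘ χ)
count-growth {χ = χ} {χ′} {new} {xs} xs! grow = begin
  ∑ xs (⟦_⟧ ∘ χ′)                    ≡⟨ count≡length-filter χ′ xs ⟩
  length (filter ?′ xs)              ≤⟨ unique⊆⇒length≤ (Unique.filter⁺ ?′ xs!) (All.tabulate old-or-new) ⟩
  length (new ++ filter ?₀ xs)       ≡⟨ length-++ new ⟩
  length new + length (filter ?₀ xs) ≡⟨ cong (length new +_) (count≡length-filter χ xs) ⟨
  length new + ∑ xs (⟦_⟧ ∘ χ)        ∎
  where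
  open ≤-Reasoning
  ?′ = λ x → χ′ x ≟ᴮ true
  ?₀ = λ x → χ x ≟ᴮ true
  old-or-new : ∀ {x} → x ∈ filter ?′ xs → x ∈ new ++ filter ?₀ xs
  old-or-new x∈ with ∈-filter⁻ ?′ {xs = xs} x∈
  ... | x∈xs , χ′x with grow _ χ′x
  ...   | inj₁ x∈new = ∈-++⁺ˡ x∈new
  ...   | inj₂ χx    = ∈-++⁺ʳ new (∈-filter⁺ ?₀ x∈xs χx)

-- A list of distinct witnesses replaces a cardinality: such lists can be mapped, split and
-- concatenated for arbitrary predicates, decidable or not.
AtLeast : ℕ → (A → Set) → Set
AtLeast n P = ∃[ xs ] n ≤ length xs × Unique xs × All P xs

module _ {P : A → Set} where

  atLeast-≤ : m ≤ n → AtLeast n P → AtLeast m P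
  atLeast-≤ m≤n (xs , n≤ , xs! , Pxs) = xs , ≤-trans m≤n n≤ , xs! , Pxs

  atLeast-zero : AtLeast 0 P
  atLeast-zero = [] , z≤n , [] , []

  atLeast-one : ∀ {x} → P x → AtLeast 1 P
  atLeast-one Px = _ ∷ [] , ≤-refl , [] ∷ [] , Px ∷ []

  atLeast-image : {f : B → A} → (∀ {x y} → f x ≡ f y → x ≡ y) → AtLeast n (P ∘ f) → AtLeast n P
  atLeast-image {f = f} inj (xs , n≤ , xs! , Pxs) =
    map f xs , subst (_ ≤_) (sym (length-map f xs)) n≤ , Unique.map⁺ inj xs! , All.map⁺ Pxs

  atLeast⇒≤length : ∀ {ys} → (∀ {x} → P x → x ∈ ys) → AtLeast n P → n ≤ length ys
  atLeast⇒≤length P⊆ (xs , n≤ , xs! , Pxs) = ≤-trans n≤ (unique⊆⇒length≤ xs! (All.map P⊆ Pxs))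

  module _ {Q : A → Set} where

    atLeast-⊆ : (∀ {x} → P x → Q x) → AtLeast n P → AtLeast n Q
    atLeast-⊆ P⊆Q (xs , n≤ , xs! , Pxs) = xs , n≤ , xs! , All.map P⊆Q Pxs

    atLeast-⊎ : (∀ {x} → P x → Q x → ⊥) →
                AtLeast m P → AtLeast n Q → AtLeast (m + n) (λ x → P x ⊎ Q x)
    atLeast-⊎ disjoint (xs , m≤ , xs! , Pxs) (ys , n≤ , ys! , Qys) =
      xs ++ ys ,
      subst (_ ≤_) (sym (length-++ xs)) (+-mono-≤ m≤ n≤) ,
      Unique.++⁺ xs! ys! (λ (∈xs , ∈ys) → disjoint (All.lookup Pxs ∈xs) (All.lookup Qys ∈ys)) ,
      All.++⁺ (All.map inj₁ Pxs) (All.map inj₂ Qys)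

    atLeast-split : {R : A → Set} → (∀ {x} → P x → Q x ⊎ R x) → AtLeast n P →
                    ∃₂ λ a b → n ≤ a + b × AtLeast a Q × AtLeast b R
    atLeast-split {n} {R} P⊆ (xs , n≤ , xs! , Pxs) with go xs! Pxs
      where
      -- The induction also carries over freshness from `xs` to both parts; this keeps them
      -- duplicate-free when the next element is put in front.
      go : ∀ {xs} → Unique xs → All P xs →
           ∃₂ λ ys zs → length xs ≡ length ys + length zs ×
             (Unique ys × All Q ys × (∀ {x} → All (x ≢_) xs → All (x ≢_) ys)) ×
             (Unique zs × All R zs × (∀ {x} → All (x ≢_) xs → All (x ≢_) zs))
      go [] [] = [] , [] , refl , ([] , [] , id) , ([] , [] , id)
      go (x∉ ∷ xs!) (Px ∷ Pxs) with P⊆ Px | go xs! Pxs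
      ... | inj₁ Qx | ys , zs , eq , (ys! , Qys , ys⊆) , (zs! , Rzs , zs⊆) =
        _ ∷ ys , zs , cong suc eq ,
        (ys⊆ x∉ ∷ ys! , Qx ∷ Qys , λ { (p ∷ ps) → p ∷ ys⊆ ps }) ,
        (zs! , Rzs , λ { (_ ∷ ps) → zs⊆ ps })
      ... | inj₂ Rx | ys , zs , eq , (ys! , Qys , ys⊆) , (zs! , Rzs , zs⊆) =
        ys , _ ∷ zs , trans (cong suc eq) (sym (+-suc (length ys) (length zs))) ,
        (ys! , Qys , λ { (_ ∷ ps) → ys⊆ ps }) ,
        (zs⊆ x∉ ∷ zs! , Rx ∷ Rzs , λ { (p ∷ ps) → p ∷ zs⊆ ps })
    ... | ys , zs , eq , (ys! , Qys , _) , (zs! , Rzs , _) =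
      length ys , length zs , subst (n ≤_) eq n≤ ,
      (ys , ≤-refl , ys! , Qys) , (zs , ≤-refl , zs! , Rzs)

atLeast-⋃ : {P : I → A → Set} {n : I → ℕ} → (∀ {i j x} → P i x → P j x → i ≡ j) →
            (∀ i → AtLeast (n i) (P i)) → ∀ {is} → Unique is →
            AtLeast (∑ is n) (λ x → ∃[ i ] i ∈ is × P i x)
atLeast-⋃ disjoint family [] = atLeast-zero
atLeast-⋃ disjoint family (i∉is ∷ is!) =
  atLeast-⊆ (λ { (inj₁ Pix) → _ , here refl , Pix
               ; (inj₂ (j , j∈ , Pjx)) → j , there j∈ , Pjx })
    (atLeast-⊎ (λ { Pix (j , j∈ , Pjx) → All.lookup i∉is j∈ (disjoint Pix Pjx) })
      (family _) (atLeast-⋃ disjoint family is!))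

-- Schedules

∈-[]≔⁻ : ∀ {xs : Vec A n} i {x y} → y ∈ⱽ xs [ i ]≔ x → y ≡ x ⊎ y ∈ⱽ xs
∈-[]≔⁻ {xs = _ ∷ _} zero    (here eq) = inj₁ eq
∈-[]≔⁻ {xs = _ ∷ _} zero    (there p) = inj₂ (there p)
∈-[]≔⁻ {xs = _ ∷ _} (suc i) (here eq) = inj₂ (here eq)
∈-[]≔⁻ {xs = _ ∷ _} (suc i) (there p) = Sum.map₂ there (∈-[]≔⁻ i p)

∈-replicate⁻ : ∀ {x y : A} → y ∈ⱽ replicate n x → y ≡ x
∈-replicate⁻ {n = suc n} (here eq) = eq
∈-replicate⁻ {n = suc n} (there p) = ∈-replicate⁻ p

Disjoint-++ : ∀ {xs ys : List A} {x} → Unique (xs ++ ys) → x ∈ xs → x ∉ ys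
Disjoint-++ {xs = x ∷ xs} (x∉ ∷ _) (here refl) x∈ys = All.lookup x∉ (∈-++⁺ʳ xs x∈ys) refl
Disjoint-++ (_ ∷ xs!) (there x∈xs) x∈ys = Disjoint-++ xs! x∈xs x∈ys

module _ {G : CDAG} {M : ℕ} where
  open CDAG G
  open Machine G M
  open State

  IsOperand : Vertex → Op → Set
  IsOperand u v = u ≡ proj₁ (operands v) ⊎ u ≡ proj₂ (operands v)

  Available : State → Vertex → Set
  Available σ v = just v ∈ⱽ fast σ ⊎ slow σ v

  writes : List Action → List Vertex
  writes []               = []
  writes (read _ ∷ as)    = writes as
  writes (write v ∷ as)   = v ∷ writes as
  writes (compute _ ∷ as) = writes as

  length-writes : ∀ as → length (writes as) ≤ wordsMoved as
  length-writes []               = z≤n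
  length-writes (read _ ∷ as)    = m≤n⇒m≤1+n (length-writes as)
  length-writes (write _ ∷ as)   = s≤s (length-writes as)
  length-writes (compute _ ∷ as) = length-writes as

  writes-++ : ∀ as {bs v} → v ∈ writes as → v ∈ writes (as ++ bs)
  writes-++ (read _ ∷ as)    v∈         = writes-++ as v∈
  writes-++ (write _ ∷ as)   (here eq)  = here eq
  writes-++ (write _ ∷ as)   (there v∈) = there (writes-++ as v∈)
  writes-++ (compute _ ∷ as) v∈         = writes-++ as v∈

  computed-++ : ∀ as bs → computed (as ++ bs) ≡ computed as ++ computed bs
  computed-++ []               bs = refl
  computed-++ (read _ ∷ as)    bs = computed-++ as bs
  computed-++ (write _ ∷ as)   bs = computed-++ as bs
  computed-++ (compute o ∷ as) bs = cong (o ∷_) (computed-++ as bs)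

  run-++ : ∀ as {bs σ τ} → Run σ (as ++ bs) τ → ∃[ ρ ] Run σ as ρ × Run ρ bs τ
  run-++ []       run           = _ , [] , run
  run-++ (a ∷ as) (first ∷ run) with run-++ as run
  ... | ρ , run₁ , run₂ = ρ , first ∷ run₁ , run₂

  -- Reads and writes only copy a value that is already in one of the memories; only `compute`
  -- brings a new one into being.
  step-available : ∀ {σ a τ o} → Step σ a τ → Available τ (inj₂ o) →
                   Available σ (inj₂ o) ⊎ o ∈ computed (a ∷ [])
  step-available (read i v∈S) (inj₁ o∈F) with ∈-[]≔⁻ i o∈F
  ... | inj₁ refl = inj₁ (inj₂ v∈S)
  ... | inj₂ o∈   = inj₁ (inj₁ o∈)
  step-available (read i v∈S) (inj₂ o∈S) = inj₁ (inj₂ o∈S)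
  step-available (write v∈F) (inj₁ o∈F) = inj₁ (inj₁ o∈F)
  step-available (write v∈F) (inj₂ (inj₁ o∈S)) = inj₁ (inj₂ o∈S)
  step-available (write v∈F) (inj₂ (inj₂ refl)) = inj₁ (inj₁ v∈F)
  step-available (compute i _ _) (inj₁ o∈F) with ∈-[]≔⁻ i o∈F
  ... | inj₁ refl = inj₂ (here refl)
  ... | inj₂ o∈   = inj₁ (inj₁ o∈)
  step-available (compute i _ _) (inj₂ o∈S) = inj₁ (inj₂ o∈S)

  -- The operand is in fast memory when `v` is computed. Following it backwards with
  -- `step-available` ends either at a computation of `u` or at the start of the run. The lemma
  -- serves both halves of a cut schedule.
  operand-origin : ∀ {σ as τ u v} → Run σ as τ → v ∈ computed as → IsOperand (inj₂ u) v →
                   Available σ (inj₂ u) ⊎ u ∈ computed as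
  operand-origin {as = a ∷ as} (first ∷ run) v∈ uv
    with ∈-++⁻ (computed (a ∷ [])) (subst (_ ∈_) (computed-++ (a ∷ []) as) v∈)
  ... | inj₂ v∈as =
    [ Sum.map₂ ∈-++ˡ ∘ step-available first , inj₂ ∘ ∈-++ʳ ]′ (operand-origin run v∈as uv)
    where
    ∈-++ˡ : ∀ {u} → u ∈ computed (a ∷ []) → u ∈ computed (a ∷ as)
    ∈-++ˡ u∈ = subst (_ ∈_) (sym (computed-++ (a ∷ []) as)) (∈-++⁺ˡ u∈)
    ∈-++ʳ : ∀ {u} → u ∈ computed as → u ∈ computed (a ∷ as)
    ∈-++ʳ u∈ = subst (_ ∈_) (sym (computed-++ (a ∷ []) as)) (∈-++⁺ʳ (computed (a ∷ [])) u∈)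
  operand-origin (compute i l∈F r∈F ∷ run) v∈ (inj₁ eq) | inj₁ (here refl) =
    inj₁ (inj₁ (subst (λ w → just w ∈ⱽ _) (sym eq) l∈F))
  operand-origin (compute i l∈F r∈F ∷ run) v∈ (inj₂ eq) | inj₁ (here refl) =
    inj₁ (inj₁ (subst (λ w → just w ∈ⱽ _) (sym eq) r∈F))

  slow-origin : ∀ {σ as τ v} → Run σ as τ → slow τ v → slow σ v ⊎ v ∈ writes as
  slow-origin [] v∈S = inj₁ v∈S
  slow-origin (read _ _ ∷ run) v∈S = slow-origin run v∈S
  slow-origin (compute _ _ _ ∷ run) v∈S = slow-origin run v∈S
  slow-origin (write _ ∷ run) v∈S with slow-origin run v∈S
  ... | inj₁ (inj₁ v∈S₀) = inj₁ v∈S₀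
  ... | inj₁ (inj₂ refl) = inj₂ (here refl)
  ... | inj₂ v∈W         = inj₂ (there v∈W)

  ¬available-initial : ∀ {o} → ¬ Available initial (inj₂ o)
  ¬available-initial (inj₁ o∈F) with ∈-replicate⁻ o∈F
  ... | ()
  ¬available-initial (inj₂ ())

  module _ (I : Implementation) where
    open Implementation I

    record Cut : Set where
      constructor split
      field
        pre post : List Action
        eq       : pre ++ post ≡ schedule

    module _ (cut : Cut) where
      open Cut cut

      computed-split : computed schedule ≡ computed pre ++ computed post
      computed-split = trans (cong computed (sym eq)) (computed-++ pre post)

      origin : ∀ o → o ∈ computed pre ⊎ o ∈ computed post
      origin o = ∈-++⁻ (computed pre) (subst (o ∈_) computed-split (computesAll o))

      -- The value is read off from the membership proof that `origin` happens to return;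
      -- `noRecompute` guarantees that no other answer is possible.
      done : Op → Bool
      done o = [ const true , const false ]′ (origin o)

      ∈pre⇒∉post : ∀ {o} → o ∈ computed pre → o ∉ computed post
      ∈pre⇒∉post = Disjoint-++ (subst Unique computed-split noRecompute)

      done⇒∈pre : ∀ {o} → done o ≡ true → o ∈ computed pre
      done⇒∈pre {o} d with origin o
      ... | inj₁ o∈ = o∈

      ¬done⇒∈post : ∀ {o} → done o ≡ false → o ∈ computed post
      ¬done⇒∈post {o} d with origin o
      ... | inj₂ o∈ = o∈

      ∈pre⇒done : ∀ {o} → o ∈ computed pre → done o ≡ true
      ∈pre⇒done {o} o∈pre with origin o
      ... | inj₁ _      = refl
      ... | inj₂ o∈post = ⊥-elim (∈pre⇒∉post o∈pre o∈post)

      runs : ∃[ ρ ] Run initial pre ρ × Run ρ post final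
      runs = run-++ pre (subst (λ as → Run initial as final) (sym eq) run)

      -- The first half starts with nothing but inputs available, so the operand of an operation in
      -- it must have been computed in it as well.
      done-closed : ∀ {u v} → IsOperand (inj₂ u) v → done v ≡ true → done u ≡ true
      done-closed uv v-done with operand-origin (proj₁ (proj₂ runs)) (done⇒∈pre v-done) uv
      ... | inj₁ avail = ⊥-elim (¬available-initial avail)
      ... | inj₂ u∈pre = ∈pre⇒done u∈pre

      memory : Vec (Maybe Vertex) M
      memory = fast (proj₁ runs)

      -- A value that is still needed cannot be recomputed: unless it is in
      -- fast memory at the cut, it must be in slow memory.
      spilled : ∀ {u v} → IsOperand (inj₂ u) v → done u ≡ true → done v ≡ false →
                just (inj₂ u) ∈ⱽ memory ⊎ inj₂ u ∈ writes schedule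
      spilled uv u-done v-pending with runs
      ... | ρ , run₁ , run₂ with operand-origin run₂ (¬done⇒∈post v-pending) uv
      ...   | inj₂ u∈post       = ⊥-elim (∈pre⇒∉post (done⇒∈pre u-done) u∈post)
      ...   | inj₁ (inj₁ u∈F)   = inj₁ u∈F
      ...   | inj₁ (inj₂ u∈S) with slow-origin run₁ u∈S
      ...     | inj₂ u∈W = inj₂ (subst (λ as → _ ∈ writes as) eq (writes-++ pre u∈W))

    progress : List Op → Cut → ℕ
    progress ops cut = ∑ ops (⟦_⟧ ∘ done cut)

    -- A discrete intermediate value argument: progress starts at 0, ends at `length ops`, and grows
    -- by at most one with each action.
    cut-at : ∀ {ops} → Unique ops → ∀ h → h ≤ length ops →
             ∃[ cut ] progress ops cut ≡ h
    cut-at {ops} ops! h h≤ = advance [] schedule refl none-done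
      where
      open ≤-Reasoning
      none-done : progress ops (split [] schedule refl) ≤ h
      none-done = begin
        progress ops (split [] schedule refl) ≡⟨ ∑-const ops 0 ⟩
        length ops * 0                      ≡⟨ *-zeroʳ (length ops) ⟩
        0                                   ≤⟨ z≤n ⟩
        h                                   ∎

      advance : ∀ pre post (eq : pre ++ post ≡ schedule) →
                progress ops (split pre post eq) ≤ h → ∃[ cut ] progress ops cut ≡ h
      -- At the end of the schedule everything is done, so progress is `length ops`, which is both
      -- at least `h` and, by the invariant, at most `h`.
      advance pre [] eq ≤h = split pre [] eq , ≤-antisym ≤h (begin
        h                             ≤⟨ h≤ ⟩
        length ops                    ≡⟨ *-identityʳ _ ⟨
        length ops * 1                ≡⟨ ∑-const ops 1 ⟨
        ∑ ops (λ _ → 1)               ≡⟨ ∑-cong (λ o → cong ⟦_⟧ (sym (all-done o))) ops ⟩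
        progress ops (split pre [] eq)  ∎)
        where
        all-done : ∀ o → done (split pre [] eq) o ≡ true
        all-done o with origin (split pre [] eq) o
        ... | inj₁ _ = refl
      advance pre (a ∷ post) eq ≤h with m≤n⇒m<n∨m≡n ≤h
      ... | inj₂ ≡h = split pre (a ∷ post) eq , ≡h
      ... | inj₁ <h = advance (pre ++ a ∷ []) post eq′ (begin
        progress ops later                               ≤⟨ count-growth {χ = done now} ops! new-or-done ⟩
        length (computed (a ∷ [])) + progress ops now    ≤⟨ +-monoˡ-≤ _ (at-most-one a) ⟩
        suc (progress ops now)                           ≤⟨ <h ⟩
        h                                                ∎)
        where
        eq′ : (pre ++ a ∷ []) ++ post ≡ schedule
        eq′ = trans (++-assoc pre (a ∷ []) post) eq
        now later : Cut
        now   = split pre (a ∷ post) eq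
        later = split (pre ++ a ∷ []) post eq′
        at-most-one : ∀ a → length (computed (a ∷ [])) ≤ 1
        at-most-one (read _)    = z≤n
        at-most-one (write _)   = z≤n
        at-most-one (compute _) = ≤-refl
        new-or-done : ∀ o → done later o ≡ true → o ∈ computed (a ∷ []) ⊎ done now o ≡ true
        new-or-done o d
          with ∈-++⁻ (computed pre) (subst (o ∈_) (computed-++ pre (a ∷ [])) (done⇒∈pre later d))
        ... | inj₁ o∈pre = inj₂ (∈pre⇒done now o∈pre)
        ... | inj₂ o∈new = inj₁ o∈new

    Pending : Cut → Op → Set
    Pending cut u = done cut u ≡ true × ∃[ v ] IsOperand (inj₂ u) v × done cut v ≡ false

    -- Of the `M + M` values at most `M` fit into fast memory at the cut, and the rest have been
    -- written. The injection `f` will select the operations of one recursive call, so that the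
    -- writes are charged to that call.
    pending⇒written : ∀ cut {A : Set} {f : A → Op} {n} → (∀ {x y} → f x ≡ f y → x ≡ y) →
                      M + M ≤ n → AtLeast n (Pending cut ∘ f) →
                      AtLeast M (λ x → inj₂ (f x) ∈ writes schedule)
    pending⇒written cut {f = f} f-injective 2M≤n pending
      with atLeast-split (λ (u-done , v , uv , v-pending) → spilled cut uv u-done v-pending) pending
    ... | a , b , n≤a+b , inMemory , written = atLeast-≤ M≤b written
      where
      open ≤-Reasoning
      a≤M : a ≤ M
      a≤M = begin
        a                             ≤⟨ atLeast⇒≤length {P = _∈ⱽ memory cut} ∈-toList⁺
                                           (atLeast-image (f-injective ∘ inj₂-injective ∘ just-injective) inMemory) ⟩
        length (toList (memory cut))  ≡⟨ length-toList (memory cut) ⟩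
        M                             ∎
      M≤b : M ≤ b
      M≤b = +-cancelˡ-≤ M _ _ (≤-trans 2M≤n (≤-trans n≤a+b (+-monoˡ-≤ b a≤M)))

-- Expansion of the computation graph

blocks : List Block
blocks = cartesianProduct (allFin 2) (allFin 2)

entries : ∀ k → List (Entry k)
entries zero    = (zero , zero) ∷ []
entries (suc k) = cartesianProductWith inBlock blocks (entries k)

length-entries : ∀ k → length (entries k) ≡ 4 ^ k
length-entries zero    = refl
length-entries (suc k) =
  trans (length-cartesianProductWith inBlock blocks (entries k)) (cong (4 *_) (length-entries k))

inBlock-injective : ∀ {n} {b b′ : Block} {e e′ : Fin n × Fin n} →
                    inBlock b e ≡ inBlock b′ e′ → b ≡ b′ × e ≡ e′
inBlock-injective {b = i , j} {i′ , j′} {x , y} {x′ , y′} eq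
  with combine-injective i x i′ x′ (cong proj₁ eq) | combine-injective j y j′ y′ (cong proj₂ eq)
... | refl , refl | refl , refl = refl , refl

entries! : ∀ k → Unique (entries k)
entries! zero    = [] ∷ []
entries! (suc k) = Unique.cartesianProductWith⁺ inBlock inBlock-injective
  (Unique.cartesianProduct⁺ (Unique.allFin⁺ 2) (Unique.allFin⁺ 2)) (entries! k)

splitEntry-inBlock : ∀ {n} (b : Block) (e : Fin n × Fin n) → splitEntry (inBlock b e) ≡ (b , e)
splitEntry-inBlock (i , j) (x , y) =
  cong₂ (λ (i , x) (j , y) → (i , j) , (x , y)) (remQuot-combine i x) (remQuot-combine j y)

inBlock-splitEntry : ∀ {n} (e : Fin (2 * n) × Fin (2 * n)) → uncurry inBlock (splitEntry {n} e) ≡ e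
inBlock-splitEntry {n} (x , y) = cong₂ _,_ (combine-remQuot {2} n x) (combine-remQuot {2} n y)

-- The terms `f e r` do not depend on the block, hence the factor `length bs`; the rest is exchange
-- of summations.
∑-rearrange : ∀ {B E R : Set} (bs : List B) (es : List E) (rs : List R) c
  (f : E → R → ℕ) (g : B → E → R → ℕ) →
  (∑ bs λ b → ∑ es λ e → ∑ rs λ r → f e r + c * g b e r) ≡
  length bs * (∑ rs λ r → ∑ es λ e → f e r) + c * (∑ es λ e → ∑ bs λ b → ∑ rs λ r → g b e r)
∑-rearrange bs es rs c f g = begin
  (∑ bs λ b → ∑ es λ e → ∑ rs λ r → f e r + c * g b e r)
    ≡⟨ ∑-cong (λ b → trans (∑-cong (λ e → trans (∑-+ rs (f e) _)
                                                (cong (∑ rs (f e) +_) (∑-* rs c (g b e)))) es)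
                           (∑-+ es _ _)) bs ⟩
  (∑ bs λ b → (∑ es λ e → ∑ rs (f e)) + (∑ es λ e → c * ∑ rs (g b e)))
    ≡⟨ ∑-+ bs _ _ ⟩
  (∑ bs λ b → ∑ es λ e → ∑ rs (f e)) + (∑ bs λ b → ∑ es λ e → c * ∑ rs (g b e))
    ≡⟨ cong₂ _+_ (trans (∑-const bs _) (cong (length bs *_) (∑-swap es rs f)))
                 (trans (∑-swap bs es _)
                 (trans (∑-cong (λ e → ∑-* bs c (λ b → ∑ rs (g b e))) es) (∑-* es c _))) ⟩
  length bs * (∑ rs λ r → ∑ es λ e → f e r) + c * (∑ es λ e → ∑ bs λ b → ∑ rs λ r → g b e r) ∎
  where open ≡-Reasoning

module _ (s : Scheme) where
  open Scheme s

  products : ∀ k → List (ScalarOp s k)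
  products zero    = mul ∷ []
  products (suc k) = cartesianProductWith call (allFin 7) (products k)

  length-products : ∀ k → length (products k) ≡ 7 ^ k
  length-products zero    = refl
  length-products (suc k) =
    trans (length-cartesianProductWith call (allFin 7) (products k)) (cong (7 *_) (length-products k))

  call-injective : ∀ {r r′} {o o′ : ScalarOp s k} → call r o ≡ call r′ o′ → r ≡ r′ × o ≡ o′
  call-injective refl = refl , refl

  products! : ∀ k → Unique (products k)
  products! zero    = [] ∷ []
  products! (suc k) = Unique.cartesianProductWith⁺ call call-injective (Unique.allFin⁺ 7) (products! k)

  resultOp-inBlock : ∀ b (e : Entry k) → resultOp s {suc k} (inBlock b e) ≡ addU (result b) e
  resultOp-inBlock {k} b e = cong (λ (b , e) → addU (result b) e) (splitEntry-inBlock {2 ^ k} b e)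

  -- The vertices of the decoding graph of one recursion level at one entry position: the seven
  -- products and the block sums formed from them. `place` puts a copy of it into the graph for each
  -- entry.
  Local : Set
  Local = Fin 7 ⊎ Fin nU

  Use : Local → Fin nU → Set
  Use x i = x ≡ proj₁ lr ⊎ x ≡ proj₂ lr
    where lr = sumVertices inj₁ (inj₂ ∘ inject) (U i)

  data Link : Local → Local → Set where
    link : ∀ {x i} → Use x i → Link x (inj₂ i)

  place : ∀ k → Entry k → Local → ScalarOp s (suc k)
  place k e (inj₁ r) = call r (resultOp s {k} e)
  place k e (inj₂ i) = addU i e

  -- Only the decoding edges, from products to block sums and between block sums. By `edge-operand`
  -- they are edges of the computation graph, so a boundary found along them is a boundary there.
  data Edge : ∀ {k} → ScalarOp s k → ScalarOp s k → Set where
    local : ∀ {k x i} {e : Entry k} → Use x i → Edge (place k e x) (addU {k = k} i e)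
    call  : ∀ {k r} {u v : ScalarOp s k} → Edge u v → Edge (call r u) (call r v)

  module _ {V W : Set} (f : V → W) {X : Set} {m} (g : X → V) (t : Fin m → V) where

    operandVertex-∘ : ∀ x → operandVertex (f ∘ g) (f ∘ t) x ≡ f (operandVertex g t x)
    operandVertex-∘ (given _) = refl
    operandVertex-∘ (step _)  = refl

    sumVertices-∘ : ∀ x → sumVertices (f ∘ g) (f ∘ t) x ≡ Product.map f f (sumVertices g t x)
    sumVertices-∘ (l ⊕ r) = cong₂ _,_ (operandVertex-∘ l) (operandVertex-∘ r)
    sumVertices-∘ (l ⊖ r) = cong₂ _,_ (operandVertex-∘ l) (operandVertex-∘ r)

  -- Stated for all `A`, `B` and `ι`, because these change on entering a recursive call. For a local
  -- edge it is naturality of `sumVertices`.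
  edge-operand : ∀ {k} {u v : ScalarOp s k} → Edge u v → ∀ {V} (A B : Entry k → V) ι →
                 ι u ≡ proj₁ (scalarOperands s A B ι v) ⊎ ι u ≡ proj₂ (scalarOperands s A B ι v)
  edge-operand (local {k} {i = i} {e} use) A B ι =
    Sum.map (λ { refl → sym (cong proj₁ natural) }) (λ { refl → sym (cong proj₂ natural) }) use
    where
    natural = sumVertices-∘ (ι ∘ place k e) inj₁ (inj₂ ∘ inject) (U i)
  edge-operand (call edge) A B ι = edge-operand edge _ _ (ι ∘ call _)

  -- All that the argument asks of a scheme: the first field keeps the copies of the decoding graph
  -- disjoint, the second keeps results out of the boundary of their own call, and the third forces
  -- a cut vertex wherever a product and a result are separated.
  record Connected : Set where
    field
      result-injective : ∀ {b b′} → result b ≡ result b′ → b ≡ b′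
      result-unused    : ∀ {b i} → ¬ Use (inj₂ (result b)) i
      connected        : ∀ r b → EqClosure Link (inj₁ r) (inj₂ (result b))

  Closed : (ScalarOp s k → Bool) → Set
  Closed χ = ∀ {u v} → Edge u v → χ v ≡ true → χ u ≡ true

  Boundary : (ScalarOp s k → Bool) → ScalarOp s k → Set
  Boundary χ u = χ u ≡ true × ∃[ v ] Edge u v × χ v ≡ false

  separated : ∀ k → (ScalarOp s k → Bool) → ℕ
  separated k χ = ∑ (entries k) λ e → ∑ (products k) λ o → differ (χ o) (χ (resultOp s {k} e))

  module Expansion (conn : Connected) where
    open Connected conn

    resultOp-injective : ∀ k {e e′ : Entry k} → resultOp s {k} e ≡ resultOp s {k} e′ → e ≡ e′
    resultOp-injective zero {zero , zero} {zero , zero} _ = refl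
    resultOp-injective (suc k) {e} {e′} eq with addU-injective eq
      where
      addU-injective : ∀ {i j} {e e′ : Entry k} → addU {s} {k} i e ≡ addU {s} {k} j e′ → i ≡ j × e ≡ e′
      addU-injective refl = refl , refl
    ... | i≡j , e≡ = trans (sym (inBlock-splitEntry {2 ^ k} e))
      (trans (cong₂ inBlock (result-injective i≡j) e≡) (inBlock-splitEntry {2 ^ k} e′))

    CutAt : ∀ k → (ScalarOp s (suc k) → Bool) → Entry k → ScalarOp s (suc k) → Set
    CutAt k χ e u = ∃₂ λ x i → u ≡ place k e x × Use x i × χ u ≡ true × χ (addU {k = k} i e) ≡ false

    -- Vertices placed at different entries differ: for block sums the entry is visible, for
    -- products it is recovered by `resultOp-injective`.
    cutAt-disjoint : ∀ {k} {χ : ScalarOp s (suc k) → Bool} {e e′ u} →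
                     CutAt k χ e u → CutAt k χ e′ u → e ≡ e′
    cutAt-disjoint {k} (x , _ , refl , _) (x′ , _ , eq , _) = place-injective x x′ eq
      where
      place-injective : ∀ {e e′} x x′ → place k e x ≡ place k e′ x′ → e ≡ e′
      place-injective (inj₁ _) (inj₁ _) eq = resultOp-injective _ (proj₂ (call-injective eq))
      place-injective (inj₂ _) (inj₂ _) refl = refl

    -- Along the walk, the first link found to change the value of `χ` gives a cut: closure under
    -- operands puts the operand inside `χ` and the sum outside.
    connected⇒≡⊎cut : ∀ k (χ : ScalarOp s (suc k) → Bool) → Closed χ → ∀ {e x y} → EqClosure Link x y →
                      χ (place k e x) ≡ χ (place k e y) ⊎ ∃ (CutAt k χ e)
    connected⇒≡⊎cut k χ closed ε = inj₁ refl
    connected⇒≡⊎cut k χ closed {e} (_◅_ {x} {y} xy walk) with connected⇒≡⊎cut k χ closed walk | sym-link xy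
      where
      across : ∀ {x y} → Link x y → χ (place k e x) ≡ χ (place k e y) ⊎ ∃ (CutAt k χ e)
      across {x} (link {i = i} use) with χ (place k e x) in eqx | χ (addU i e) in eqi
      ... | true  | true  = inj₁ refl
      ... | false | false = inj₁ refl
      ... | true  | false = inj₂ (_ , x , i , refl , use , eqx , eqi)
      ... | false | true  with () ← trans (sym eqx) (closed (local use) eqi)
      sym-link : ∀ {x y} → SymClosure Link x y → χ (place k e x) ≡ χ (place k e y) ⊎ ∃ (CutAt k χ e)
      sym-link (fwd l) = across l
      sym-link (bwd l) = Sum.map₁ sym (across l)
    ... | inj₂ cut | _        = inj₂ cut
    ... | inj₁ _   | inj₂ cut = inj₂ cut
    ... | inj₁ p   | inj₁ q   = inj₁ (trans q p)

    crossings : ∀ k → (ScalarOp s (suc k) → Bool) → Entry k → ℕ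
    crossings k χ e = ∑ blocks λ b → ∑ (allFin 7) λ r →
      differ (χ (call r (resultOp s {k} e))) (χ (addU {k = k} (result b) e))

    -- A copy has 4 · 7 = 28 pairs of a result and a product. Either none is separated, or a single
    -- cut vertex pays for all of them.
    crossings-bound : ∀ k (χ : ScalarOp s (suc k) → Bool) → Closed χ → ∀ e →
                      ∃[ n ] crossings k χ e ≤ 28 * n × AtLeast n (CutAt k χ e)
    crossings-bound k χ closed e
      with ∑≡0⊎ (λ b → ∑≡0⊎ (λ r → Sum.map₁ differ-≡ (connected⇒≡⊎cut k χ closed {e} (connected r b)))
                             (allFin 7)) blocks
    ... | inj₁ ≡0        = 0 , ≤-reflexive ≡0 , atLeast-zero
    ... | inj₂ (_ , cut) = 1 , ∑-mono (λ b → ∑-mono (λ r →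
      differ≤1 (χ (call r (resultOp s {k} e))) (χ (addU {k = k} (result b) e))) (allFin 7)) blocks ,
      atLeast-one cut

    -- Triangle inequality through the entry `e` of the result of call `r`, where the pair consists
    -- of a product inside call `r` and the result at `(b , e)`. The first leg is shared by the 4
    -- blocks, the second by the `7 ^ k` products of the call.
    separated-split : ∀ k (χ : ScalarOp s (suc k) → Bool) →
      separated (suc k) χ ≤
      4 * ∑ (allFin 7) (λ r → separated k (χ ∘ call r)) + 7 ^ k * ∑ (entries k) (crossings k χ)
    separated-split k χ = begin
      separated (suc k) χ
        ≡⟨ trans (∑-cartesianProductWith inBlock blocks (entries k) (λ e → ∑ (products (suc k)) (pair e)))
             (∑-cong (λ b → ∑-cong (λ e →
             trans (∑-cartesianProductWith call (allFin 7) (products k) (pair (inBlock b e)))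
                   (cong (λ u → ∑ (allFin 7) λ r → ∑ (products k) λ o → differ (χ (call r o)) (χ u))
                         (resultOp-inBlock {k} b e))) (entries k)) blocks) ⟩
      (∑ blocks λ b → ∑ (entries k) λ e → ∑ (allFin 7) λ r → ∑ (products k) λ o →
         differ (χ (call r o)) (χ (addU {k = k} (result b) e)))
        ≤⟨ ∑-mono (λ b → ∑-mono (λ e → ∑-mono (via-child b e) (allFin 7)) (entries k)) blocks ⟩
      (∑ blocks λ b → ∑ (entries k) λ e → ∑ (allFin 7) λ r → inner e r + 7 ^ k * outer b e r)
        ≡⟨ ∑-rearrange blocks (entries k) (allFin 7) (7 ^ k) inner outer ⟩
      4 * ∑ (allFin 7) (λ r → separated k (χ ∘ call r)) + 7 ^ k * ∑ (entries k) (crossings k χ)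
        ∎
      where
      open ≤-Reasoning
      pair : Entry (suc k) → ScalarOp s (suc k) → ℕ
      pair e o = differ (χ o) (χ (resultOp s {suc k} e))
      inner : Entry k → Fin 7 → ℕ
      inner e r = ∑ (products k) λ o → differ (χ (call r o)) (χ (call r (resultOp s {k} e)))
      outer : Block → Entry k → Fin 7 → ℕ
      outer b e r = differ (χ (call r (resultOp s {k} e))) (χ (addU {k = k} (result b) e))
      via-child : ∀ b e r → (∑ (products k) λ o → differ (χ (call r o)) (χ (addU {k = k} (result b) e))) ≤
                            inner e r + 7 ^ k * outer b e r
      via-child b e r = begin
        (∑ (products k) λ o → differ (χ (call r o)) (χ (addU {k = k} (result b) e)))
          ≤⟨ ∑-mono (λ o → differ-triangle (χ (call r o)) (χ (call r (resultOp s {k} e)))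
                                           (χ (addU {k = k} (result b) e))) (products k) ⟩
        (∑ (products k) λ o → differ (χ (call r o)) (χ (call r (resultOp s {k} e))) + outer b e r)
          ≡⟨ ∑-+ (products k) (λ o → differ (χ (call r o)) (χ (call r (resultOp s {k} e))))
                 (λ _ → outer b e r) ⟩
        inner e r + (∑ (products k) λ _ → outer b e r)
          ≡⟨ cong (inner e r +_) (trans (∑-const (products k) _)
                                        (cong (_* outer b e r) (length-products k))) ⟩
        inner e r + 7 ^ k * outer b e r ∎

    -- Results are left out, so that the result of a call is counted only once,
    -- among the operands of the block sums of the surrounding call.
    Inner : (ScalarOp s k → Bool) → ScalarOp s k → Set
    Inner {k} χ u = Boundary χ u × (∀ e → u ≢ resultOp s {k} e)

    -- Induction along `separated-split`. The children contribute 16 · 7ᵏ per boundary vertex,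
    -- within the allowed 28 · 7ᵏ; the crossings contribute exactly 28 · 7ᵏ. No vertex is counted
    -- twice, since a copy at this level meets a child only in its results, which `Inner` leaves
    -- out.
    expansion : ∀ k (χ : ScalarOp s k → Bool) → Closed χ →
                ∃[ n ] separated k χ ≤ 4 * 7 ^ k * n × AtLeast n (Inner χ)
    -- The only product is itself the only result, so no pair is separated.
    expansion zero χ closed = 0 , ≤-reflexive (cong (λ d → d + 0 + 0) (differ-≡ {χ mul} refl)) , atLeast-zero
    expansion (suc k) χ closed = ∑ (allFin 7) within + ∑ (entries k) between , bound ,
      atLeast-⊆ inner
        (atLeast-⊎ (λ { (r , _ , u , refl , inner) (e , _ , x , i , eq , _) → child-not-local x eq inner })
          (atLeast-⋃ (λ { (u , refl , _) (u′ , eq , _) → proj₁ (call-injective eq) })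
            (λ r → atLeast-image (proj₂ ∘ call-injective)
              (atLeast-⊆ (λ inner → _ , refl , inner) (proj₂ (proj₂ (child r)))))
            (Unique.allFin⁺ 7))
          (atLeast-⋃ (cutAt-disjoint {χ = χ}) (λ e → proj₂ (proj₂ (crossings-bound k χ closed e))) (entries! k)))
      where
      open ≤-Reasoning
      child : ∀ r → ∃[ n ] separated k (χ ∘ call r) ≤ 4 * 7 ^ k * n × AtLeast n (Inner (χ ∘ call r))
      child r = expansion k (χ ∘ call r) (closed ∘ call)
      within : Fin 7 → ℕ
      within r = proj₁ (child r)
      between : Entry k → ℕ
      between e = proj₁ (crossings-bound k χ closed e)
      bound : separated (suc k) χ ≤ 4 * 7 ^ suc k * (∑ (allFin 7) within + ∑ (entries k) between)
      bound = begin
        separated (suc k) χ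
          ≤⟨ separated-split k χ ⟩
        4 * ∑ (allFin 7) (λ r → separated k (χ ∘ call r)) + 7 ^ k * ∑ (entries k) (crossings k χ)
          ≤⟨ +-mono-≤ (*-monoʳ-≤ 4 (≤-trans (∑-mono (λ r → proj₁ (proj₂ (child r))) (allFin 7))
                                            (≤-reflexive (∑-* (allFin 7) (4 * 7 ^ k) within))))
                      (*-monoʳ-≤ (7 ^ k) (≤-trans (∑-mono (λ e → proj₁ (proj₂ (crossings-bound k χ closed e))) (entries k))
                                                  (≤-reflexive (∑-* (entries k) 28 between)))) ⟩
        4 * (4 * 7 ^ k * ∑ (allFin 7) within) + 7 ^ k * (28 * ∑ (entries k) between)
          ≡⟨ cong (_+ 7 ^ k * (28 * ∑ (entries k) between)) (*-assoc 4 (4 * 7 ^ k) _) ⟨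
        4 * (4 * 7 ^ k) * ∑ (allFin 7) within + 7 ^ k * (28 * ∑ (entries k) between)
          ≤⟨ arith (7 ^ k) (∑ (allFin 7) within) (∑ (entries k) between) ⟩
        4 * 7 ^ suc k * (∑ (allFin 7) within + ∑ (entries k) between) ∎
        where
        arith : ∀ c x y → 4 * (4 * c) * x + c * (28 * y) ≤ 4 * (7 * c) * (x + y)
        arith c x y = subst (4 * (4 * c) * x + c * (28 * y) ≤_) (expand c x y) (m≤n+m _ (12 * c * x))
          where
          expand : ∀ c x y → 12 * c * x + (4 * (4 * c) * x + c * (28 * y)) ≡ 4 * (7 * c) * (x + y)
          expand = solve-∀
      child-not-local : ∀ {χ′ : ScalarOp s k → Bool} {r u e} x → call r u ≡ place k e x → ¬ Inner χ′ u
      child-not-local (inj₁ r) refl (_ , not-result) = not-result _ refl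
      inner : ∀ {v} →
              (∃[ r ] _ × ∃[ u ] v ≡ call r u × Inner (χ ∘ call r) u) ⊎ (∃[ e ] _ × CutAt k χ e v) →
              Inner χ v
      inner (inj₁ (r , _ , u , refl , (u-done , v , uv , v-pending) , _)) =
        (u-done , call r v , call uv , v-pending) , λ _ ()
      inner (inj₂ (e , _ , inj₁ r , i , refl , use , u-done , v-pending)) =
        (u-done , addU i e , local use , v-pending) , λ _ ()
      -- A block sum that has a user at this level is not a result of the call.
      inner (inj₂ (e , _ , inj₂ j , i , refl , use , u-done , v-pending)) =
        (u-done , addU i e , local use , v-pending) , λ e′ → λ { refl → result-unused use }

-- Boundaries and writes of the recursive calls

half≤mixed : ∀ {A : Set} (χ : A → Bool) xs {h} → ∑ xs (⟦_⟧ ∘ χ) ≡ h → h + h ≤ length xs →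
             ∀ c → h ≤ ∑ xs (λ x → differ (χ x) c)
-- The value `false` differs from the `h` marked elements.
half≤mixed χ xs refl 2h≤ false = ≤-reflexive (∑-cong (differ-false ∘ χ) xs)
  where
  differ-false : ∀ b → ⟦ b ⟧ ≡ differ b false
  differ-false false = refl
  differ-false true  = refl
-- The value `true` differs from the unmarked elements, of which there are at least `h` because the
-- marked ones are at most half.
half≤mixed χ xs {h} refl 2h≤ true = +-cancelˡ-≤ h _ _ (begin
  h + h                                       ≤⟨ 2h≤ ⟩
  length xs                                   ≡⟨ *-identityʳ _ ⟨
  length xs * 1                               ≡⟨ ∑-const xs 1 ⟨
  (∑ xs λ _ → 1)                              ≡⟨ ∑-cong (differ-true ∘ χ) xs ⟩
  (∑ xs λ x → ⟦ χ x ⟧ + differ (χ x) true)    ≡⟨ ∑-+ xs (⟦_⟧ ∘ χ) _ ⟩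
  h + (∑ xs λ x → differ (χ x) true)          ∎)
  where
  open ≤-Reasoning
  differ-true : ∀ b → 1 ≡ ⟦ b ⟧ + differ b true
  differ-true false = refl
  differ-true true  = refl

module _ {s : Scheme} where

  embed : ∀ {d j} → Vec (Fin 7) d → ScalarOp s j → ScalarOp s (d + j)
  embed []       o = o
  embed (r ∷ rs) o = call r (embed rs o)

  embed-injective : ∀ {d j} (rs : Vec (Fin 7) d) {o o′ : ScalarOp s j} → embed rs o ≡ embed rs o′ → o ≡ o′
  embed-injective []       eq = eq
  embed-injective (r ∷ rs) eq = embed-injective rs (proj₂ (call-injective s eq))

  embed-edge : ∀ {d j} (rs : Vec (Fin 7) d) {u v : ScalarOp s j} → Edge s u v → Edge s (embed rs u) (embed rs v)
  embed-edge []       uv = uv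
  embed-edge (r ∷ rs) uv = call (embed-edge rs uv)

  -- Different calls have no operation in common: the outermost index separates seven families, and
  -- the induction treats each of them.
  atLeast-embed : ∀ d {j m} {P : ScalarOp s (d + j) → Set} →
                  (∀ rs → AtLeast m (P ∘ embed {d} rs)) → AtLeast (7 ^ d * m) P
  atLeast-embed zero {m = m} family = atLeast-≤ (≤-reflexive (+-identityʳ m)) (family [])
  atLeast-embed (suc d) {m = m} {P} family =
    atLeast-≤ (≤-reflexive (trans (*-assoc 7 (7 ^ d) m) (sym (∑-const (allFin 7) (7 ^ d * m)))))
      (atLeast-⊆ (λ { (_ , _ , Pv , _) → Pv })
        -- The predicate also records the call that contains `v`, which makes the seven families
        -- disjoint.
        (atLeast-⋃ {P = λ r v → P v × ∃[ u ] v ≡ call r u}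
          (λ { (_ , _ , refl) (_ , _ , eq) → proj₁ (call-injective s eq) })
          (λ r → atLeast-image (proj₂ ∘ call-injective s)
            (atLeast-⊆ (λ Pu → Pu , _ , refl) (atLeast-embed d (λ rs → family (r ∷ rs)))))
          (Unique.allFin⁺ 7)))

  module _ (conn : Connected s) where
    open Expansion s conn

    minority-separated : ∀ k (χ : ScalarOp s k → Bool) {h} →
      ∑ (products s k) (⟦_⟧ ∘ χ) ≡ h → h + h ≤ 7 ^ k → 4 ^ k * h ≤ separated s k χ
    minority-separated k χ {h} count≡h 2h≤ = begin
      4 ^ k * h                 ≡⟨ cong (_* h) (length-entries k) ⟨
      length (entries k) * h    ≡⟨ ∑-const (entries k) h ⟨
      (∑ (entries k) λ _ → h)   ≤⟨ ∑-mono (λ e → half≤mixed χ (products s k) count≡h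
                                     (subst (h + h ≤_) (sym (length-products s k)) 2h≤)
                                     (χ (resultOp s {k} e))) (entries k) ⟩
      separated s k χ           ∎
      where open ≤-Reasoning

    -- `3 * 7 ^ i` is the largest multiple of `7 ^ i` within half of the products. Each of the
    -- `4 ^ suc i` results is separated from at least that many products; comparison with
    -- `expansion` and cancellation of `7 ^ i` give the bound.
    balanced-boundary : ∀ i (χ : ScalarOp s (suc i) → Bool) → Closed s χ →
      ∑ (products s (suc i)) (⟦_⟧ ∘ χ) ≡ 3 * 7 ^ i →
      ∃[ n ] 3 * 4 ^ suc i ≤ 28 * n × AtLeast n (Boundary s χ)
    balanced-boundary i χ closed balanced =
      let n , separated≤ , boundary = expansion (suc i) χ closed
      in n , *-cancelˡ-≤ (7 ^ i) {{m^n≢0 7 i}} (bound n separated≤) , atLeast-⊆ proj₁ boundary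
      where
      open ≤-Reasoning
      minority : 3 * 7 ^ i + 3 * 7 ^ i ≤ 7 ^ suc i
      minority = begin
        3 * 7 ^ i + 3 * 7 ^ i   ≡⟨ *-distribʳ-+ (7 ^ i) 3 3 ⟨
        6 * 7 ^ i               ≤⟨ *-monoˡ-≤ (7 ^ i) (n≤1+n 6) ⟩
        7 ^ suc i               ∎
      bound : ∀ n → separated s (suc i) χ ≤ 4 * 7 ^ suc i * n → 7 ^ i * (3 * 4 ^ suc i) ≤ 7 ^ i * (28 * n)
      bound n separated≤ = begin
        7 ^ i * (3 * 4 ^ suc i)   ≡⟨ regroup₁ (7 ^ i) (4 ^ suc i) ⟩
        4 ^ suc i * (3 * 7 ^ i)   ≤⟨ minority-separated (suc i) χ balanced minority ⟩
        separated s (suc i) χ     ≤⟨ separated≤ ⟩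
        4 * 7 ^ suc i * n         ≡⟨ regroup₂ (7 ^ i) n ⟩
        7 ^ i * (28 * n)          ∎
        where
        regroup₁ : ∀ x y → x * (3 * y) ≡ y * (3 * x)
        regroup₁ = solve-∀
        regroup₂ : ∀ x n → 4 * (7 * x) * n ≡ x * (28 * n)
        regroup₂ = solve-∀

    module _ {M} (d i : ℕ) (56M≤ : 56 * M ≤ 3 * 4 ^ suc i)
             (I : Machine.Implementation (schemeCDAG s (d + suc i)) M) where
      open Machine.Implementation I

      -- Calls may be interleaved in the schedule, so each gets a cut of its own, placed by the
      -- progress on its own products. Only writes of its own values are counted.
      written-in-call : ∀ (rs : Vec (Fin 7) d) → AtLeast M (λ o → inj₂ (embed rs o) ∈ writes schedule)
      written-in-call rs =
        let cut , progress≡ = cut-at I {map (embed rs) (products s (suc i))}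
              (Unique.map⁺ (embed-injective rs) (products! s (suc i))) (3 * 7 ^ i) few
            n , 3·4^j≤28n , boundary = balanced-boundary i (done I cut ∘ embed rs)
              (λ uv → done-closed I cut (embedded-operand uv))
              (trans (cong sum (map-∘ (products s (suc i)))) progress≡)
        in pending⇒written I cut (embed-injective rs) (2M≤ n 3·4^j≤28n)
             (atLeast-⊆ (λ (u-done , v , uv , v-pending) →
                           u-done , embed rs v , embedded-operand uv , v-pending) boundary)
        where
        open ≤-Reasoning
        embedded-operand : ∀ {u v} → Edge s u v →
                           IsOperand {schemeCDAG s (d + suc i)} {M} (inj₂ (embed rs u)) (embed rs v)
        embedded-operand uv = edge-operand s (embed-edge rs uv) _ _ inj₂
        few : 3 * 7 ^ i ≤ length (map (embed rs) (products s (suc i)))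
        few = begin
          3 * 7 ^ i                                    ≤⟨ *-monoˡ-≤ (7 ^ i) (m≤m+n 3 4) ⟩
          7 ^ suc i                                    ≡⟨ length-products s (suc i) ⟨
          length (products s (suc i))                  ≡⟨ length-map (embed rs) (products s (suc i)) ⟨
          length (map (embed rs) (products s (suc i))) ∎
        -- The constant 56 is 2 · 28, so that the boundary exceeds fast memory by a further `M`.
        2M≤ : ∀ n → 3 * 4 ^ suc i ≤ 28 * n → M + M ≤ n
        2M≤ n 3·4^j≤28n = *-cancelˡ-≤ 28 (begin
          28 * (M + M)      ≡⟨ cong (λ x → 28 * (M + x)) (+-identityʳ M) ⟨
          28 * (2 * M)      ≡⟨ *-assoc 28 2 M ⟨
          56 * M            ≤⟨ 56M≤ ⟩
          3 * 4 ^ suc i     ≤⟨ 3·4^j≤28n ⟩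
          28 * n            ∎)

      communication-bound : 7 ^ d * M ≤ communication
      communication-bound = ≤-trans
        (atLeast⇒≤length {P = _∈ writes schedule} id
          (atLeast-image inj₂-injective (atLeast-embed d written-in-call)))
        (length-writes schedule)

-- Choice of the recursion depth and the exponent log₂ 7

power-of-4-above : ∀ M → 1 ≤ M → ∃[ a ] M ≤ 4 ^ a × 4 ^ a ≤ 4 * M
power-of-4-above (suc zero) _ = 0 , ≤-refl , m≤m+n 1 3
power-of-4-above (suc M@(suc _)) _ with power-of-4-above M (s≤s z≤n)
... | a , M≤ , ≤4M with m≤n⇒m<n∨m≡n M≤
...   | inj₁ M<  = a , M< , ≤-trans ≤4M (*-monoʳ-≤ 4 (n≤1+n M))
-- Here `M` is exactly `4 ^ a`, so its successor requires the next power.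
...   | inj₂ M≡  = suc a ,
  ≤-trans (≤-trans (+-mono-≤ {1} {M} (s≤s z≤n) (m≤m+n M 0)) (*-monoˡ-≤ M (m≤m+n 2 2)))
          (≤-reflexive (cong (4 *_) M≡)) ,
  ≤-trans (≤-reflexive (cong (4 *_) (sym M≡))) (*-monoʳ-≤ 4 (n≤1+n M))

-- A call of the least suitable height j has 4 ^ j ≤ 4 ^ 4 * M: this costs a
-- factor 7 ^ 4, and such calls exist when n ≥ 4 ^ 2 * √ M.
factor : ℚ
factor = mkℚ (pos 1) 2400 (1-coprimeTo 2401)

threshold : ℚ
threshold = mkℚ (pos 16) 0 (coprime-sym (1-coprimeTo 16))

^-distribʳ-* : ∀ a b n → (a * b) ^ n ≡ a ^ n * b ^ n
^-distribʳ-* a b zero    = refl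
^-distribʳ-* a b (suc n) = trans (cong (a * b *_) (^-distribʳ-* a b n)) (interchange a b (a ^ n) (b ^ n))
  where
  interchange : ∀ a b x y → a * b * (x * y) ≡ a * x * (b * y)
  interchange = solve-∀

^-swap : ∀ b m n → (b ^ m) ^ n ≡ (b ^ n) ^ m
^-swap b m n = trans (^-*-assoc b m n) (trans (cong (b ^_) (*-comm m n)) (sym (^-*-assoc b n m)))

-- Here `e` counts the levels lost to constants. Squared, n is `4 ^ k`, and `2 ^ p ≤ 7 ^ q` turns
-- the `p`-th power of `4 ^ (e + d)` into at most the `2 * q`-th power of `7 ^ (e + d)`. The factor
-- `7 ^ d` is absorbed by `w`, and `7 ^ e` stays as the constant.
power-bound : ∀ M k d e w → 4 ^ k ≤ 4 ^ (e + d) * M → 7 ^ d * M ≤ w →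
              ∀ p q → 2 ^ p ≤ 7 ^ q →
              M ^ (2 * q) * (2 ^ k) ^ (2 * p) ≤ (7 ^ e * w) ^ (2 * q) * M ^ p
power-bound M k d e w 4^k≤ w≥ p q 2^p≤7^q = begin
  M ^ (2 * q) * (2 ^ k) ^ (2 * p)
    ≡⟨ cong (M ^ (2 * q) *_) (trans (sym (^-*-assoc (2 ^ k) 2 p)) (cong (_^ p) (^-swap 2 k 2))) ⟩
  M ^ (2 * q) * (4 ^ k) ^ p
    ≤⟨ *-monoʳ-≤ (M ^ (2 * q)) (^-monoˡ-≤ p 4^k≤) ⟩
  M ^ (2 * q) * (4 ^ (e + d) * M) ^ p
    ≡⟨ cong (M ^ (2 * q) *_) (^-distribʳ-* (4 ^ (e + d)) M p) ⟩
  M ^ (2 * q) * ((4 ^ (e + d)) ^ p * M ^ p)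
    ≤⟨ *-monoʳ-≤ (M ^ (2 * q)) (*-monoˡ-≤ (M ^ p) 4-power≤7-power) ⟩
  M ^ (2 * q) * ((7 ^ (e + d)) ^ (2 * q) * M ^ p)
    ≡⟨ *-assoc (M ^ (2 * q)) _ _ ⟨
  M ^ (2 * q) * (7 ^ (e + d)) ^ (2 * q) * M ^ p
    ≡⟨ cong (_* M ^ p) (^-distribʳ-* M (7 ^ (e + d)) (2 * q)) ⟨
  (M * 7 ^ (e + d)) ^ (2 * q) * M ^ p
    ≡⟨ cong (λ x → x ^ (2 * q) * M ^ p)
            (trans (cong (M *_) (^-distribˡ-+-* 7 e d)) (rotate M (7 ^ e) (7 ^ d))) ⟩
  (7 ^ e * (7 ^ d * M)) ^ (2 * q) * M ^ p
    ≤⟨ *-monoˡ-≤ (M ^ p) (^-monoˡ-≤ (2 * q) (*-monoʳ-≤ (7 ^ e) w≥)) ⟩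
  (7 ^ e * w) ^ (2 * q) * M ^ p
    ∎
  where
  open ≤-Reasoning
  rotate : ∀ x y z → x * (y * z) ≡ y * (z * x)
  rotate = solve-∀
  exponents : ∀ x y → x * (2 * y) ≡ y * (2 * x)
  exponents = solve-∀
  4-power≤7-power : (4 ^ (e + d)) ^ p ≤ (7 ^ (e + d)) ^ (2 * q)
  4-power≤7-power = begin
    (4 ^ (e + d)) ^ p        ≡⟨ ^-*-assoc 4 (e + d) p ⟩
    4 ^ ((e + d) * p)        ≡⟨ ^-*-assoc 2 2 ((e + d) * p) ⟩
    2 ^ (2 * ((e + d) * p))  ≡⟨ cong (2 ^_) (exponents′ (e + d) p) ⟩
    2 ^ (p * (2 * (e + d)))  ≡⟨ ^-*-assoc 2 p (2 * (e + d)) ⟨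
    (2 ^ p) ^ (2 * (e + d))  ≤⟨ ^-monoˡ-≤ (2 * (e + d)) 2^p≤7^q ⟩
    (7 ^ q) ^ (2 * (e + d))  ≡⟨ ^-*-assoc 7 q (2 * (e + d)) ⟩
    7 ^ (q * (2 * (e + d)))  ≡⟨ cong (7 ^_) (exponents q (e + d)) ⟩
    7 ^ ((e + d) * (2 * q))  ≡⟨ ^-*-assoc 7 (e + d) (2 * q) ⟨
    (7 ^ (e + d)) ^ (2 * q)  ∎
    where
    exponents′ : ∀ x y → 2 * (x * y) ≡ y * (2 * x)
    exponents′ = solve-∀

lower-bound : ∀ {s} → Connected s → ∀ M k → 1 ≤ M → (2 ^ k) ≥ threshold √ M →
  (I : Machine.Implementation (schemeCDAG s k) M) →
  Machine.Implementation.communication I ≥ factor ⟨ 2 ^ k /√ M ⟩^log₂7·M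
lower-bound {s} conn M k 1≤M large = at-depth (k ∸ suc (2 + a) , m∸n+n≡m j≤k)
  where
  open ≤-Reasoning
  a : ℕ
  a = proj₁ (power-of-4-above M 1≤M)
  M≤4^a : M ≤ 4 ^ a
  M≤4^a = proj₁ (proj₂ (power-of-4-above M 1≤M))
  4^j≤256M : 4 ^ (3 + a) ≤ 4 ^ 4 * M
  4^j≤256M = begin
    4 ^ (3 + a)      ≡⟨ ^-distribˡ-+-* 4 3 a ⟩
    4 ^ 3 * 4 ^ a    ≤⟨ *-monoʳ-≤ (4 ^ 3) (proj₂ (proj₂ (power-of-4-above M 1≤M))) ⟩
    4 ^ 3 * (4 * M)  ≡⟨ *-assoc (4 ^ 3) 4 M ⟨
    4 ^ 4 * M        ∎
  56M≤ : 56 * M ≤ 3 * 4 ^ (3 + a)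
  56M≤ = begin
    -- Three levels above `4 ^ a` are enough, as 3 · 4³ = 192 = 56 + 136; two would give only 48.
    56 * M               ≤⟨ *-mono-≤ (m≤m+n 56 136) M≤4^a ⟩
    3 * 4 ^ 3 * 4 ^ a    ≡⟨ *-assoc 3 (4 ^ 3) (4 ^ a) ⟩
    3 * (4 ^ 3 * 4 ^ a)  ≡⟨ cong (3 *_) (^-distribˡ-+-* 4 3 a) ⟨
    3 * 4 ^ (3 + a)      ∎
  j≤k : 3 + a ≤ k
  j≤k = ≮⇒≥ λ k<j → <⇒≱ (^-monoʳ-< 4 (s≤s (s≤s z≤n)) k<j) (begin
    4 ^ (3 + a)      ≤⟨ 4^j≤256M ⟩
    -- The squared `threshold` is 16² = 4⁴, so a `k` below the height would give `4 ^ k < 4 ^ k`.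
    4 ^ 4 * M        ≤⟨ large ⟩
    1 * (2 ^ k) ^ 2  ≡⟨ *-identityˡ _ ⟩
    (2 ^ k) ^ 2      ≡⟨ ^-swap 2 k 2 ⟩
    4 ^ k            ∎)
  -- Generalised over `k`, so that matching on the equation turns it into depth plus height, the
  -- form in `communication-bound`.
  at-depth : ∀ {k} → (∃[ d ] d + suc (2 + a) ≡ k) → (I : Machine.Implementation (schemeCDAG s k) M) →
             Machine.Implementation.communication I ≥ factor ⟨ 2 ^ k /√ M ⟩^log₂7·M
  at-depth (d , refl) I p q 2^p≤7^q =
    subst (λ x → x ^ (2 * q) * (2 ^ (d + (3 + a))) ^ (2 * p) ≤ (7 ^ 4 * w) ^ (2 * q) * M ^ p)
      (sym (*-identityˡ M))
      (power-bound M (d + (3 + a)) d 4 w 4^k≤ (communication-bound conn d (2 + a) 56M≤ I) p q 2^p≤7^q)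
    where
    w : ℕ
    w = Machine.Implementation.communication I
    4^k≤ : 4 ^ (d + (3 + a)) ≤ 4 ^ (4 + d) * M
    4^k≤ = begin
      4 ^ (d + (3 + a))        ≡⟨ ^-distribˡ-+-* 4 d (3 + a) ⟩
      4 ^ d * 4 ^ (3 + a)      ≤⟨ *-monoʳ-≤ (4 ^ d) 4^j≤256M ⟩
      4 ^ d * (4 ^ 4 * M)      ≡⟨ *-assoc (4 ^ d) (4 ^ 4) M ⟨
      4 ^ d * 4 ^ 4 * M        ≡⟨ cong (_* M) (*-comm (4 ^ d) (4 ^ 4)) ⟩
      4 ^ 4 * 4 ^ d * M        ≡⟨ cong (_* M) (^-distribˡ-+-* 4 4 d) ⟨
      4 ^ (4 + d) * M          ∎

-- Strassen's and Winograd's schemes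

module _ {s : Scheme} where
  open Scheme s

  Use? : ∀ x i → Dec (Use s x i)
  Use? x i = ≡-dec _≟ᶠ_ _≟ᶠ_ x _ ⊎-dec ≡-dec _≟ᶠ_ _≟ᶠ_ x _

  module _ {x y : Local s} where

    infixr 5 _at_↑_ _↓_

    -- Notation for walks in the decoding graph: `↑` passes from an operand to the sum `i`, and `↓`
    -- from a sum to one of its operands.
    _at_↑_ : ∀ i → Use s x i → EqClosure (Link s) (inj₂ i) y → EqClosure (Link s) x y
    i at use ↑ walk = fwd (link use) ◅ walk

    _↓_ : ∀ {i} → Use s x i → EqClosure (Link s) x y → EqClosure (Link s) (inj₂ i) y
    use ↓ walk = bwd (link use) ◅ walk

  -- Walks to a common base can be reversed and joined, and a left inverse of `result` shows that it
  -- is injective.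
  connected-via : ∀ {base} → (∀ x → EqClosure (Link s) x base) →
                  (block : Fin nU → Block) → (∀ b → block (result b) ≡ b) →
                  (∀ i j l → ¬ Use s (inj₂ (result (i , j))) l) → Connected s
  connected-via to block block-result unused = record
    { result-injective = λ {b} {b′} eq →
        trans (sym (block-result b)) (trans (cong block eq) (block-result b′))
    ; result-unused = unused _ _ _
    ; connected     = λ r b → to (inj₁ r) ◅◅ symmetric (Link s) (to (inj₂ (result b)))
    }

pattern left  = inj₁ refl
pattern right = inj₂ refl

strassen-connected : Connected strassen
strassen-connected = connected-via to-M₁
  -- The last clause inverts `result` at `#8` and is a mere default on the intermediate sums.
  (λ { #3 → #1 , #1 ; #4 → #1 , #2 ; #5 → #2 , #1 ; _ → #2 , #2 })
  (λ { (#1 , #1) → refl ; (#1 , #2) → refl ; (#2 , #1) → refl ; (#2 , #2) → refl })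
  (from-yes (all? λ i → all? λ j → all? λ l →
     ¬? (Use? {strassen} (inj₂ (Scheme.result strassen (i , j))) l)))
  where
  -- Each product other than M₁ is the right operand of a sum whose chain of left operands ends in
  -- M₁. Among the sums, only C₁₂ and C₂₁ do not contain M₁; they first go down to M₅ and M₄.
  to-M₁ : ∀ x → EqClosure (Link strassen) x (inj₁ #1)
  to-M₁ (inj₁ #1) = ε
  to-M₁ (inj₁ #2) = #6 at right ↑ left ↓ ε
  to-M₁ (inj₁ #3) = #7 at right ↑ left ↓ left ↓ ε
  to-M₁ (inj₁ #4) = #1 at right ↑ left ↓ ε
  to-M₁ (inj₁ #5) = #2 at right ↑ left ↓ left ↓ ε
  to-M₁ (inj₁ #6) = #8 at right ↑ left ↓ left ↓ left ↓ ε
  to-M₁ (inj₁ #7) = #3 at right ↑ left ↓ left ↓ left ↓ ε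
  to-M₁ (inj₂ #1) = left ↓ ε
  to-M₁ (inj₂ #2) = left ↓ left ↓ ε
  to-M₁ (inj₂ #3) = left ↓ left ↓ left ↓ ε
  to-M₁ (inj₂ #4) = right ↓ #2 at right ↑ left ↓ left ↓ ε
  to-M₁ (inj₂ #5) = right ↓ #1 at right ↑ left ↓ ε
  to-M₁ (inj₂ #6) = left ↓ ε
  to-M₁ (inj₂ #7) = left ↓ left ↓ ε
  to-M₁ (inj₂ #8) = left ↓ left ↓ left ↓ ε

winograd-connected : Connected winograd
winograd-connected = connected-via to-P₁
  (λ { #1 → #1 , #1 ; #5 → #1 , #2 ; #6 → #2 , #1 ; _ → #2 , #2 })
  (λ { (#1 , #1) → refl ; (#1 , #2) → refl ; (#2 , #1) → refl ; (#2 , #2) → refl })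
  (from-yes (all? λ i → all? λ j → all? λ l →
     ¬? (Use? {winograd} (inj₂ (Scheme.result winograd (i , j))) l)))
  where
  -- In this variant the left operands of every block sum lead down to P₁.
  to-P₁ : ∀ x → EqClosure (Link winograd) x (inj₁ #1)
  to-P₁ (inj₁ #1) = ε
  to-P₁ (inj₁ #2) = #1 at right ↑ left ↓ ε
  to-P₁ (inj₁ #3) = #5 at right ↑ left ↓ left ↓ left ↓ ε
  to-P₁ (inj₁ #4) = #6 at right ↑ left ↓ left ↓ left ↓ ε
  to-P₁ (inj₁ #5) = #4 at right ↑ left ↓ left ↓ ε
  to-P₁ (inj₁ #6) = #2 at right ↑ left ↓ ε
  to-P₁ (inj₁ #7) = #3 at right ↑ left ↓ left ↓ ε
  to-P₁ (inj₂ #1) = left ↓ ε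
  to-P₁ (inj₂ #2) = left ↓ ε
  to-P₁ (inj₂ #3) = left ↓ left ↓ ε
  to-P₁ (inj₂ #4) = left ↓ left ↓ ε
  to-P₁ (inj₂ #5) = left ↓ left ↓ left ↓ ε
  to-P₁ (inj₂ #6) = left ↓ left ↓ left ↓ ε
  to-P₁ (inj₂ #7) = left ↓ left ↓ left ↓ ε

mainTheorem1 : (∃[ c ] ∃[ c₀ ] (0ℚ <ℚ c) × (1ℚ ≤ℚ c₀) ×
    (∀ (M k : ℕ) → 1 ≤ M → (2 ^ k) ≥ c₀ √ M →
    (I : Machine.Implementation (schemeCDAG strassen k) M) →
    Machine.Implementation.communication I ≥ c ⟨ 2 ^ k /√ M ⟩^log₂7·M))
    ×
    (∃[ c ] ∃[ c₀ ] (0ℚ <ℚ c) × (1ℚ ≤ℚ c₀) ×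
    (∀ (M k : ℕ) → 1 ≤ M → (2 ^ k) ≥ c₀ √ M →
    (I : Machine.Implementation (schemeCDAG winograd k) M) →
    Machine.Implementation.communication I ≥ c ⟨ 2 ^ k /√ M ⟩^log₂7·M))
mainTheorem1 = bound strassen-connected , bound winograd-connected
  where
  bound : ∀ {s} → Connected s → ∃[ c ] ∃[ c₀ ] (0ℚ <ℚ c) × (1ℚ ≤ℚ c₀) ×
    (∀ (M k : ℕ) → 1 ≤ M → (2 ^ k) ≥ c₀ √ M →
    (I : Machine.Implementation (schemeCDAG s k) M) →
    Machine.Implementation.communication I ≥ c ⟨ 2 ^ k /√ M ⟩^log₂7·M)
  bound conn = factor , threshold , *<* (+<+ (s≤s z≤n)) , *≤* (+≤+ (s≤s z≤n)) , lower-bound conn
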